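{- The following decision problem can be solved in time linear in the size of $G$. Input: a graph $G$, an attack $A\subseteq V(G)$, and positive integers $k$ and $\delta$. Question: is there a $k$-defense $D$ such that $\mathcal{U}_{\mathrm{def}}(G,D,A)\ge\delta$?
   Context: Graphs are finite, simple and undirected, with vertex set $V(G)$ and edge set $E(G)$; the size of $G$ is $|V(G)|+|E(G)|$. A ($k$-)defense in $G$ is a set $D\subseteq V(G)$ of (at most $k$) vertices; an ($\ell$-)attack is a set $A\subseteq V(G)$ of (at most $\ell$) vertices. Given a defense $D$ and an attack $A$, a vertex $v\in V(G)\setminus A$ survives if the graph $G-A$ (obtained by deleting the vertices of $A$) contains a path from $v$ to some vertex in $D$ (a path may consist of a single vertex). The payoff $\mathcal{U}_{\mathrm{def}}(G,D,A)$ is the number of vertices that survive under defense $D$ and attack $A$. -}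

module Defs where

open import Level using (0ℓ)
open import Data.Bool.Base using (if_then_else_)
open import Data.Nat.Base using (ℕ; zero; suc; pred; _+_; _*_; _≤_; _<_; z≤n; s≤s)
open import Data.Nat using (_≟_)
open import Data.Fin.Base using (Fin; toℕ)
import Data.Fin.Properties as Fin
open import Data.Fin.Subset using (Subset; ∣_∣) renaming (_∈_ to _∈ˢ_; _∉_ to _∉ˢ_)
open import Data.Fin.Subset.Properties using () renaming (_∈?_ to _∈ˢ?_)
open import Data.List.Base
  using (List; []; _∷_; length; map; concat; take; allFin; applyUpTo;
         cartesianProduct; filter; head; last; lookup)
open import Data.Nat.ListAction using (sum)
open import Data.List.Membership.Propositional using (_∈_)
open import Data.List.Membership.Propositional.Properties using (∈-lookup)
open import Data.List.Relation.Unary.All as All using (All)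
open import Data.List.Relation.Unary.AllPairs using (_∷_)
open import Data.List.Relation.Unary.Linked using (Linked; linked?)
open import Data.List.Relation.Unary.Unique.Propositional using (Unique)
open import Data.Maybe.Base using (just)
import Data.Maybe.Properties as Maybe
open import Data.Product.Base using (∃-syntax; _×_; _,_)
open import Data.Sum.Base using (_⊎_; inj₁; inj₂)
import Data.Vec.Base as Vec
open import Function.Base using (_∘_)
open import Function.Bundles using (_⇔_)
open import Relation.Binary.Core using (Rel)
open import Relation.Binary.Definitions using (Decidable; Symmetric; Irreflexive)
open import Relation.Binary.PropositionalEquality using (_≡_; refl; sym; cong)
open import Relation.Nullary using (Dec; yes; no; does; ¬?; contradiction)
open import Relation.Nullary.Decidable using (map′; _×-dec_; _⊎-dec_)
import Relation.Unary as Unary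

import Data.List.Relation.Unary.Unique.DecPropositional as DecUnique

------------------------------------------------------------------------
-- Graphs, attacks, defenses, payoff

record Graph (n : ℕ) : Set₁ where
  infix 4 _~_ _~?_
  field
    _~_    : Rel (Fin n) 0ℓ
    _~?_   : Decidable _~_
    ~-sym  : Symmetric _~_
    ~-irr  : Irreflexive _≡_ _~_

  -- Each edge {u , v} is listed once, as the pair (u , v) with u < v.
  edges : List (Fin n × Fin n)
  edges = filter (λ (u , v) → (u Fin.<? v) ×-dec (u ~? v))
                 (cartesianProduct (allFin n) (allFin n))

  size : ℕ
  size = n + length edges

module _ {n : ℕ} (G : Graph n) where
  open Graph G

  -- vs is the vertex sequence of a path from v to w in G - A.
  record IsPath (A : Subset n) (v w : Fin n) (vs : List (Fin n)) : Set where
    constructor isPath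
    field
      starts   : head vs ≡ just v
      ends     : last vs ≡ just w
      adjacent : Linked _~_ vs
      distinct : Unique vs
      avoids   : All (_∉ˢ A) vs

  Survives : (D A : Subset n) → Fin n → Set
  Survives D A v = v ∉ˢ A × ∃[ w ] (w ∈ˢ D × ∃[ vs ] IsPath A v w vs)

  -- Survival is decidable: a path has at most n vertices, so there are only
  -- finitely many candidate vertex sequences.
  isPath? : ∀ A v w → Unary.Decidable (IsPath A v w)
  isPath? A v w vs =
    map′ (λ (s , e , l , u , a) → isPath s e l u a)
         (λ (isPath s e l u a) → s , e , l , u , a)
         (Maybe.≡-dec Fin._≟_ (head vs) (just v)
           ×-dec Maybe.≡-dec Fin._≟_ (last vs) (just w)
           ×-dec linked? _~?_ vs
           ×-dec DecUnique.unique? Fin._≟_ vs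
           ×-dec All.all? (λ x → ¬? (x ∈ˢ? A)) vs)

  boundedList? : ∀ m {P : List (Fin n) → Set} → Unary.Decidable P →
                 Dec (∃[ vs ] (length vs ≤ m × P vs))
  boundedList? zero P? =
    map′ (λ p → [] , z≤n , p) (λ { ([] , _ , p) → p }) (P? [])
  boundedList? (suc m) P? =
    map′ (λ { (inj₁ p)                → [] , z≤n , p
            ; (inj₂ (v , vs , l , p)) → v ∷ vs , s≤s l , p })
         (λ { ([]     , _     , p) → inj₁ p
            ; (v ∷ vs , s≤s l , p) → inj₂ (v , vs , l , p) })
         (P? [] ⊎-dec Fin.any? (λ v → boundedList? m (P? ∘ (v ∷_))))

  lookup-injective : ∀ {vs : List (Fin n)} → Unique vs →
                     ∀ {i j} → lookup vs i ≡ lookup vs j → i ≡ j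
  lookup-injective (_ ∷ _) {Fin.zero}  {Fin.zero}  _  = refl
  lookup-injective (x∉ ∷ _) {Fin.zero} {Fin.suc j} eq =
    contradiction eq (All.lookup x∉ (∈-lookup j))
  lookup-injective (x∉ ∷ _) {Fin.suc i} {Fin.zero} eq =
    contradiction (sym eq) (All.lookup x∉ (∈-lookup i))
  lookup-injective (_ ∷ u) {Fin.suc i} {Fin.suc j} eq =
    cong Fin.suc (lookup-injective u eq)

  survives? : ∀ D A → Unary.Decidable (Survives D A)
  survives? D A v =
    ¬? (v ∈ˢ? A) ×-dec Fin.any? λ w → (w ∈ˢ? D) ×-dec
      map′ (λ (vs , _ , p) → vs , p)
           (λ (vs , p) → vs , Fin.injective⇒≤ (lookup-injective (IsPath.distinct p)) , p)
           (boundedList? n (isPath? A v w))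

  survivors : (D A : Subset n) → Subset n
  survivors D A = Vec.tabulate (λ v → does (survives? D A v))

  payoff : (D A : Subset n) → ℕ
  payoff D A = ∣ survivors D A ∣

------------------------------------------------------------------------
-- Machine model

-- A unit-cost random access machine with registers 0, 1, 2, … and arrays
-- 0, 1, 2, … of natural numbers (a fixed program mentions finitely many of
-- them, so the arrays can be interleaved in a single memory at constant
-- cost). Arithmetic is limited to adding or subtracting one, so that after t
-- steps no number exceeds t plus the largest input or program constant, and
-- charging one step per instruction does not hide arithmetic on long numbers.

Reg Arr : Set
Reg = ℕ
Arr = ℕ

infixr 5 _⨾_

data Program : Set where
  skip      : Program
  const     : Reg → ℕ → Program
  copy      : Reg → Reg → Program
  inc dec   : Reg → Program
  load      : Reg → Arr → Reg → Program          -- load x a i   is  x := a[i]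
  store     : Arr → Reg → Reg → Program          -- store a i x  is  a[i] := x
  _⨾_       : Program → Program → Program
  ifLess    : Reg → Reg → Program → Program → Program
  whileLess : Reg → Reg → Program → Program

record State : Set where
  constructor state
  field
    reg : Reg → ℕ
    arr : Arr → ℕ → ℕ

open State public

infixl 9 _[_↦_]

_[_↦_] : ∀ {a} {X : Set a} → (ℕ → X) → ℕ → X → (ℕ → X)
(f [ i ↦ x ]) j = if does (j ≟ i) then x else f j

setReg : Reg → ℕ → State → State
setReg x m (state r a) = state (r [ x ↦ m ]) a

setArr : Arr → ℕ → ℕ → State → State
setArr b i m (state r a) = state r (a [ b ↦ a b [ i ↦ m ] ])

-- P , σ ⇓ σ′ # t : started in σ, the program P halts in σ′ after t steps.
infix 4 _,_⇓_#_

data _,_⇓_#_ : Program → State → State → ℕ → Set where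
  ⇓skip  : ∀ {σ} → skip , σ ⇓ σ # 1
  ⇓const : ∀ {σ x m} → const x m , σ ⇓ setReg x m σ # 1
  ⇓copy  : ∀ {σ x y} → copy x y , σ ⇓ setReg x (reg σ y) σ # 1
  ⇓inc   : ∀ {σ x} → inc x , σ ⇓ setReg x (suc (reg σ x)) σ # 1
  ⇓dec   : ∀ {σ x} → dec x , σ ⇓ setReg x (pred (reg σ x)) σ # 1
  ⇓load  : ∀ {σ x a i} → load x a i , σ ⇓ setReg x (arr σ a (reg σ i)) σ # 1
  ⇓store : ∀ {σ a i x} → store a i x , σ ⇓ setArr a (reg σ i) (reg σ x) σ # 1
  ⇓seq   : ∀ {P Q σ σ′ σ″ s t} →
           P , σ ⇓ σ′ # s → Q , σ′ ⇓ σ″ # t → P ⨾ Q , σ ⇓ σ″ # s + t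
  ⇓then  : ∀ {x y P Q σ σ′ t} → reg σ x < reg σ y →
           P , σ ⇓ σ′ # t → ifLess x y P Q , σ ⇓ σ′ # suc t
  ⇓else  : ∀ {x y P Q σ σ′ t} → reg σ y ≤ reg σ x →
           Q , σ ⇓ σ′ # t → ifLess x y P Q , σ ⇓ σ′ # suc t
  ⇓stop  : ∀ {x y P σ} → reg σ y ≤ reg σ x → whileLess x y P , σ ⇓ σ # 1
  ⇓loop  : ∀ {x y P σ σ′ σ″ s t} → reg σ x < reg σ y →
           P , σ ⇓ σ′ # s → whileLess x y P , σ′ ⇓ σ″ # t →
           whileLess x y P , σ ⇓ σ″ # suc (s + t)

-- One program and one constant serve all instances; the answer is "yes" iff
-- register 0 finally holds 1. The bound is c (1 + size) because even an input
-- of size 0 takes some steps.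
SolvableInLinearTime : ∀ {a b} {I : Set a} (encode : I → State) (size : I → ℕ)
                       (Question : I → Set b) → Set _
SolvableInLinearTime {I = I} encode size Question =
  ∃[ P ] ∃[ c ] ∀ (i : I) → ∃[ σ ] ∃[ t ]
    (P , encode i ⇓ σ # t × t ≤ c * suc (size i) × (reg σ 0 ≡ 1 ⇔ Question i))

------------------------------------------------------------------------
-- Instances and their encoding

-- Adjacency lists, each in an arbitrary order.
record AdjacencyLists {n : ℕ} (G : Graph n) : Set where
  open Graph G
  field
    neighbours : Fin n → List (Fin n)
    unique     : ∀ v → Unique (neighbours v)
    complete   : ∀ {v w} → w ∈ neighbours v ⇔ v ~ w

  degrees : List ℕ
  degrees = map (length ∘ neighbours) (allFin n)

  -- The list of vertex v occupies the positions from entry v (inclusive) to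
  -- entry v + 1 (exclusive) of the offsets in the concatenated lists.
  offsets : List ℕ
  offsets = applyUpTo (λ v → sum (take v degrees)) (suc n)

  targets : List ℕ
  targets = map toℕ (concat (map neighbours (allFin n)))

record Instance : Set₁ where
  field
    {n}      : ℕ
    graph    : Graph n
    adjLists : AdjacencyLists graph
    attack   : Subset n
    k δ      : ℕ
    k>0      : 0 < k
    δ>0      : 0 < δ

cells : List ℕ → ℕ → ℕ
cells []       _       = 0
cells (x ∷ _)  zero    = x
cells (_ ∷ xs) (suc i) = cells xs i

-- Registers 0, 1, 2 hold n, k, δ; arrays 0, 1, 2 hold the offsets and targets
-- of the adjacency lists and the 0/1 indicator of the attack. All other
-- memory is 0.
encode : Instance → State
encode I = state
  (cells (n ∷ k ∷ δ ∷ []))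
  λ { 0 → cells offsets
    ; 1 → cells targets
    ; 2 → cells (Vec.toList (Vec.map (λ b → if b then 1 else 0) attack))
    ; _ → λ _ → 0 }
  where
    open Instance I
    open AdjacencyLists adjLists

{-# OPTIONS --safe #-}
module Submission where

-- A defense gains exactly the components of G - A that it meets, so a best
-- k-defense puts one vertex into each of the k largest components. Its payoff
-- can be computed without sorting the components by size: counted by columns,
-- the k largest sizes add up to the sum over j of min(k, number of components
-- with more than j vertices) (columnSum, with columnSum-attained and
-- columnSum-upper; optimal-payoff draws the conclusion for defenses).
--
-- A breadth-first search of G - A maintains this sum while it runs: the j-th
-- vertex scanned in a component, counted from 0, shows that the component has
-- more than j vertices and so adds one to column j, unless that column has
-- reached k already. The whole search is a single loop whose rounds follow
-- one arc, scan one vertex, start one component or pass one root. The lemmas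
-- followArc-round, scanVertex-round and tryRoot-round show that every branch
-- keeps an invariant and lowers a potential, which is initially at most 3
-- times the size of G since the degrees add up to at most twice the number
-- of edges (sum-degrees≤). Every round takes boundedly many steps, which
-- gives linear time; the final sum is then compared with δ.

open import Defs
open import Algebra.Properties.CommutativeSemigroup using (interchange)
open import Data.Bool.Base using (true; false; if_then_else_)
open import Data.Fin.Base using (Fin; zero; suc; toℕ; fromℕ<)
import Data.Fin.Properties as Fin
open import Data.Fin.Subset using (Subset; ∣_∣) renaming (_∈_ to _∈ˢ_; _∉_ to _∉ˢ_)
open import Data.Fin.Subset.Properties using () renaming (_∈?_ to _∈ˢ?_)
open import Data.List.Base
  using (List; []; _∷_; _++_; length; map; concat; take; drop; filter; applyUpTo;
         allFin; tabulate)
import Data.List.Membership.DecPropositional as DecMembership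
open import Data.List.Membership.Propositional using (_∈_; _∉_; find; lose)
open import Data.List.Membership.Propositional.Properties
import Data.List.Properties as List
open import Data.List.Relation.Binary.Permutation.Propositional as Perm
  using (_↭_; ↭-refl; ↭-sym; ↭-trans; ↭-reflexive)
open import Data.List.Relation.Binary.Permutation.Propositional.Properties as Perm
  using (∈-resp-↭; ↭-length; shift; shifts; ++⁺ˡ; ++⁺ʳ)
open import Data.List.Relation.Unary.All as All using (All; []; _∷_)
import Data.List.Relation.Unary.All.Properties as All
open import Data.List.Relation.Unary.AllPairs using ([]; _∷_)
open import Data.List.Relation.Unary.Any using (Any; here; there; any?)
open import Data.List.Relation.Unary.Linked as Linked using (Linked; [-]; _∷_)
import Data.List.Relation.Unary.Linked.Properties as Linked
open import Data.List.Relation.Unary.Unique.Propositional using (Unique)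
import Data.List.Relation.Unary.Unique.Propositional.Properties as Unique
open import Data.Nat using (_≟_; _<?_)
open import Data.Nat.Base
  using (ℕ; zero; suc; _+_; _*_; _∸_; _⊓_; _≤_; _<_; z≤n; s≤s; s<s)
open import Data.Nat.Induction using (Acc; acc; <-wellFounded)
open import Data.Nat.ListAction using (sum)
open import Data.Nat.ListAction.Properties using (sum-↭)
open import Data.Nat.Properties hiding (_≟_; _<?_)
open import Data.Product.Base using (∃-syntax; _×_; _,_; proj₁; proj₂; swap)
open import Data.Sum.Base using (_⊎_; inj₁; inj₂)
import Data.Vec.Base as Vec
import Data.Vec.Properties as Vec
open import Function.Base using (_∘_; id; flip)
open import Function.Bundles using (_⇔_; mk⇔; module Equivalence)
open import Relation.Binary.Bundles using (DecTotalOrder)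
open import Relation.Binary.Construct.Closure.ReflexiveTransitive
  using (Star; ε; _◅_; _◅◅_; reverse)
import Relation.Binary.Construct.Flip.EqAndOrd as Flip
import Relation.Binary.Construct.On as On
open import Relation.Binary.Definitions using (tri<; tri≈; tri>)
open import Relation.Binary.PropositionalEquality
  using (_≡_; _≢_; refl; sym; trans; cong; cong₂; subst; subst₂)
open import Relation.Nullary using (Dec; yes; no; does; ¬?; contradiction)
open import Relation.Nullary.Decidable using (dec-true; dec-false)
import Relation.Unary as Unary

------------------------------------------------------------------------
-- Duplicate-free lists and subsets

unique-⊆⇒length≤ : ∀ {a} {X : Set a} {xs ys : List X} → Unique xs →
                   (∀ {x} → x ∈ xs → x ∈ ys) → length xs ≤ length ys
unique-⊆⇒length≤ [] _ = z≤n
unique-⊆⇒length≤ {xs = x ∷ xs} (x∉ ∷ u) sub with ∈-∃++ (sub (here refl))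
... | as , bs , refl = subst (suc (length xs) ≤_) (sym (↭-length (shift x as bs)))
        (s≤s (unique-⊆⇒length≤ u λ y∈ → strip y∈ (∈-resp-↭ (shift x as bs) (sub (there y∈)))))
  where
    strip : ∀ {y} → y ∈ xs → y ∈ x ∷ as ++ bs → y ∈ as ++ bs
    strip y∈ (here refl) = contradiction refl (All.lookup x∉ y∈)
    strip y∈ (there y∈′) = y∈′

unique-++ˡ : ∀ {a} {X : Set a} (xs : List X) {ys} → Unique (xs ++ ys) → Unique xs
unique-++ˡ []       _        = []
unique-++ˡ (x ∷ xs) (x∉ ∷ u) = All.++⁻ˡ xs x∉ ∷ unique-++ˡ xs u

unique-++ʳ : ∀ {a} {X : Set a} (xs : List X) {ys} → Unique (xs ++ ys) → Unique ys
unique-++ʳ []       u       = u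
unique-++ʳ (x ∷ xs) (_ ∷ u) = unique-++ʳ xs u

unique-++-disjoint : ∀ {a} {X : Set a} (xs : List X) {ys x} → Unique (xs ++ ys) →
                     x ∈ xs → x ∉ ys
unique-++-disjoint (x ∷ xs) (x∉ ∷ _) (here refl) x∈ys = All.lookup (All.++⁻ʳ xs x∉) x∈ys refl
unique-++-disjoint (x ∷ xs) (_ ∷ u)  (there x∈)  x∈ys = unique-++-disjoint xs u x∈ x∈ys

unique-resp-↭ : ∀ {a} {X : Set a} {xs ys : List X} → xs ↭ ys → Unique xs → Unique ys
unique-resp-↭ Perm.refl u = u
unique-resp-↭ (Perm.prep x p) (x∉ ∷ u) = Perm.All-resp-↭ p x∉ ∷ unique-resp-↭ p u
unique-resp-↭ (Perm.swap x y p) ((x≢y ∷ x∉) ∷ y∉ ∷ u) =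
  ((x≢y ∘ sym) ∷ Perm.All-resp-↭ p y∉) ∷ Perm.All-resp-↭ p x∉ ∷ unique-resp-↭ p u
unique-resp-↭ (Perm.trans p q) u = unique-resp-↭ q (unique-resp-↭ p u)

concat-resp-↭ : ∀ {a} {X : Set a} {xss yss : List (List X)} → xss ↭ yss → concat xss ↭ concat yss
concat-resp-↭ Perm.refl = ↭-refl
concat-resp-↭ (Perm.prep xs p) = ++⁺ˡ xs (concat-resp-↭ p)
concat-resp-↭ (Perm.swap xs ys p) =
  ↭-trans (++⁺ˡ xs (++⁺ˡ ys (concat-resp-↭ p))) (shifts xs ys)
concat-resp-↭ (Perm.trans p q) = ↭-trans (concat-resp-↭ p) (concat-resp-↭ q)

-- The elements of a subset, in increasing order.
members : ∀ {n} → Subset n → List (Fin n)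
members Vec.[]            = []
members (true  Vec.∷ p) = zero ∷ map suc (members p)
members (false Vec.∷ p) = map suc (members p)

length-members : ∀ {n} (p : Subset n) → length (members p) ≡ ∣ p ∣
length-members Vec.[]          = refl
length-members (true  Vec.∷ p) =
  cong suc (trans (List.length-map suc (members p)) (length-members p))
length-members (false Vec.∷ p) = trans (List.length-map suc (members p)) (length-members p)

unique-members : ∀ {n} (p : Subset n) → Unique (members p)
unique-members Vec.[]          = []
unique-members (true  Vec.∷ p) =
  All.map⁺ (All.universal (λ _ ()) (members p)) ∷ Unique.map⁺ Fin.suc-injective (unique-members p)
unique-members (false Vec.∷ p) = Unique.map⁺ Fin.suc-injective (unique-members p)

∈-members⁺ : ∀ {n} {p : Subset n} {x} → x ∈ˢ p → x ∈ members p
∈-members⁺ {p = true  Vec.∷ p} Vec.here       = here refl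
∈-members⁺ {p = true  Vec.∷ p} (Vec.there x∈) = there (∈-map⁺ suc (∈-members⁺ x∈))
∈-members⁺ {p = false Vec.∷ p} (Vec.there x∈) = ∈-map⁺ suc (∈-members⁺ x∈)

∈-members⁻ : ∀ {n} {p : Subset n} {x} → x ∈ members p → x ∈ˢ p
∈-members⁻ {p = true  Vec.∷ p} (here refl) = Vec.here
∈-members⁻ {p = true  Vec.∷ p} (there x∈) with ∈-map⁻ suc x∈
... | y , y∈ , refl = Vec.there (∈-members⁻ y∈)
∈-members⁻ {p = false Vec.∷ p} x∈ with ∈-map⁻ suc x∈
... | y , y∈ , refl = Vec.there (∈-members⁻ y∈)

unique⇒length≤∣∣ : ∀ {n} {p : Subset n} {xs} → Unique xs → (∀ {x} → x ∈ xs → x ∈ˢ p) →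
                   length xs ≤ ∣ p ∣
unique⇒length≤∣∣ {p = p} u sub =
  subst (_ ≤_) (length-members p) (unique-⊆⇒length≤ u (∈-members⁺ ∘ sub))

⊆⇒∣∣≤length : ∀ {n} {p : Subset n} {xs} → (∀ {x} → x ∈ˢ p → x ∈ xs) → ∣ p ∣ ≤ length xs
⊆⇒∣∣≤length {p = p} sub =
  subst (_≤ _) (length-members p) (unique-⊆⇒length≤ (unique-members p) (sub ∘ ∈-members⁻))

-- Membership in the subset cut out by a decidable predicate.
module _ {n p} {P : Fin n → Set p} (P? : Unary.Decidable P) where

  ∈-tabulate-does⁺ : ∀ {x} → P x → x ∈ˢ Vec.tabulate (does ∘ P?)
  ∈-tabulate-does⁺ {x} px = Vec.lookup⇒[]= x _
    (trans (Vec.lookup∘tabulate (does ∘ P?) x) (dec-true (P? x) px))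

  ∈-tabulate-does⁻ : ∀ {x} → x ∈ˢ Vec.tabulate (does ∘ P?) → P x
  ∈-tabulate-does⁻ {x} x∈ with P? x | trans (sym (Vec.lookup∘tabulate (does ∘ P?) x)) (Vec.[]=⇒lookup x∈)
  ... | yes px | _ = px
  ... | no  _  | ()

------------------------------------------------------------------------
-- The largest total length of k lists

-- The sum of f 0, …, f (n - 1).
Σ< : ℕ → (ℕ → ℕ) → ℕ
Σ< n f = sum (applyUpTo f n)

Σ<-mono : ∀ n {f g : ℕ → ℕ} → (∀ j → f j ≤ g j) → Σ< n f ≤ Σ< n g
Σ<-mono zero    f≤g = z≤n
Σ<-mono (suc n) f≤g = +-mono-≤ (f≤g 0) (Σ<-mono n (f≤g ∘ suc))

Σ<-cong : ∀ n {f g : ℕ → ℕ} → (∀ j → f j ≡ g j) → Σ< n f ≡ Σ< n g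
Σ<-cong zero    f≡g = refl
Σ<-cong (suc n) f≡g = cong₂ _+_ (f≡g 0) (Σ<-cong n (f≡g ∘ suc))

Σ<-+ : ∀ n (f g : ℕ → ℕ) → Σ< n (λ j → f j + g j) ≡ Σ< n f + Σ< n g
Σ<-+ zero    f g = refl
Σ<-+ (suc n) f g = trans (cong ((f 0 + g 0) +_) (Σ<-+ n (f ∘ suc) (g ∘ suc)))
  (interchange +-commutativeSemigroup (f 0) (g 0) _ _)

Σ<-0 : ∀ n → Σ< n (λ _ → 0) ≡ 0
Σ<-0 zero    = refl
Σ<-0 (suc n) = Σ<-0 n

Σ<-increment : ∀ {n m} {f g : ℕ → ℕ} → m < n → g m ≡ suc (f m) → (∀ j → j ≢ m → g j ≡ f j) →
               Σ< n g ≡ suc (Σ< n f)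
Σ<-increment {suc n} {zero} {f} {g} _ eq same =
  cong₂ _+_ eq (Σ<-cong n (λ j → same (suc j) λ ()))
Σ<-increment {suc n} {suc m} {f} {g} (s≤s m<n) eq same =
  trans (cong₂ _+_ (same 0 λ ()) (Σ<-increment m<n eq (λ j j≢m → same (suc j) (j≢m ∘ suc-injective))))
        (+-suc (f 0) _)

-- exceeds j m is 1 if j < m and 0 otherwise.
exceeds : ℕ → ℕ → ℕ
exceeds _       zero    = 0
exceeds zero    (suc m) = 1
exceeds (suc j) (suc m) = exceeds j m

exceeds≤1 : ∀ j m → exceeds j m ≤ 1
exceeds≤1 j       zero    = z≤n
exceeds≤1 zero    (suc m) = s≤s z≤n
exceeds≤1 (suc j) (suc m) = exceeds≤1 j m

exceeds-mono : ∀ j {m n} → m ≤ n → exceeds j m ≤ exceeds j n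
exceeds-mono j       z≤n       = z≤n
exceeds-mono zero    (s≤s m≤n) = s≤s z≤n
exceeds-mono (suc j) (s≤s m≤n) = exceeds-mono j m≤n

exceeds-self : ∀ m → exceeds m m ≡ 0
exceeds-self zero    = refl
exceeds-self (suc m) = exceeds-self m

exceeds-suc : ∀ m → exceeds m (suc m) ≡ 1
exceeds-suc zero    = refl
exceeds-suc (suc m) = exceeds-suc m

exceeds-suc-≢ : ∀ j m → j ≢ m → exceeds j (suc m) ≡ exceeds j m
exceeds-suc-≢ zero    zero    j≢m = contradiction refl j≢m
exceeds-suc-≢ zero    (suc m) j≢m = refl
exceeds-suc-≢ (suc j) zero    j≢m = refl
exceeds-suc-≢ (suc j) (suc m) j≢m = exceeds-suc-≢ j m (j≢m ∘ cong suc)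

Σ<-exceeds≤ : ∀ n m → Σ< n (λ j → exceeds j m) ≤ m
Σ<-exceeds≤ n       zero    = ≤-reflexive (Σ<-0 n)
Σ<-exceeds≤ zero    (suc m) = z≤n
Σ<-exceeds≤ (suc n) (suc m) = s≤s (Σ<-exceeds≤ n m)

Σ<-exceeds : ∀ {n m} → m ≤ n → Σ< n (λ j → exceeds j m) ≡ m
Σ<-exceeds {n} z≤n   = Σ<-0 n
Σ<-exceeds (s≤s m≤n) = cong suc (Σ<-exceeds m≤n)

module _ {a} {X : Set a} where

  -- The number of lists of length greater than j.
  #longer : ℕ → List (List X) → ℕ
  #longer j xss = sum (map (exceeds j ∘ length) xss)

  -- The total length of the k longest lists, counted by columns as in a
  -- Young diagram: among the k longest lists, those longer than j are k
  -- or all lists longer than j, whichever is fewer. Only the columns below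
  -- n are counted, so n should bound all lengths.
  columnSum : ℕ → ℕ → List (List X) → ℕ
  columnSum n k xss = Σ< n (λ j → k ⊓ #longer j xss)

  #longer≤length : ∀ j xss → #longer j xss ≤ length xss
  #longer≤length j []         = z≤n
  #longer≤length j (xs ∷ xss) = +-mono-≤ (exceeds≤1 j (length xs)) (#longer≤length j xss)

  #longer-resp-↭ : ∀ j {xss yss} → xss ↭ yss → #longer j xss ≡ #longer j yss
  #longer-resp-↭ j p = sum-↭ (Perm.map⁺ (exceeds j ∘ length) p)

  length-concat-columns : ∀ n xss → All (λ xs → length xs ≤ n) xss →
                          Σ< n (λ j → #longer j xss) ≡ length (concat xss)
  length-concat-columns n []         []       = Σ<-0 n
  length-concat-columns n (xs ∷ xss) (l ∷ ls) =
    trans (Σ<-+ n (λ j → exceeds j (length xs)) (λ j → #longer j xss))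
    (trans (cong₂ _+_ (Σ<-exceeds l) (length-concat-columns n xss ls))
           (sym (List.length-++ xs)))

  -- With at most k lists the cut-off at k has no effect.
  columnSum-upper : ∀ n k xss → All (λ xs → length xs ≤ n) xss → length xss ≤ k →
                    length (concat xss) ≤ columnSum n k xss
  columnSum-upper n k xss ls l≤k = subst (_≤ columnSum n k xss) (length-concat-columns n xss ls)
    (Σ<-mono n λ j → ⊓-glb (≤-trans (#longer≤length j xss) l≤k) ≤-refl)

  #longer-filter : ∀ j {p} {P : List X → Set p} (P? : Unary.Decidable P) xss →
                   #longer j (filter P? xss) ≤ #longer j xss
  #longer-filter j P? []         = z≤n
  #longer-filter j P? (xs ∷ xss) with does (P? xs)
  ... | true  = +-monoʳ-≤ (exceeds j (length xs)) (#longer-filter j P? xss)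
  ... | false = m≤n⇒m≤o+n (exceeds j (length xs)) (#longer-filter j P? xss)

  columnSum-filter : ∀ n k {p} {P : List X → Set p} (P? : Unary.Decidable P) xss →
                     columnSum n k (filter P? xss) ≤ columnSum n k xss
  columnSum-filter n k P? xss = Σ<-mono n λ j → ⊓-monoʳ-≤ k (#longer-filter j P? xss)

  byDecreasingLength : DecTotalOrder _ _ _
  byDecreasingLength = On.decTotalOrder (Flip.decTotalOrder ≤-decTotalOrder) (length {A = X})

  open import Data.List.Sort byDecreasingLength using (sort; sort-↭; sort-↗)

  #longer-bounded : ∀ j m {xss} → exceeds j m ≡ 0 → All (λ xs → length xs ≤ m) xss →
                    #longer j xss ≡ 0
  #longer-bounded j m e []       = refl
  #longer-bounded j m e (l ∷ ls) =
    cong₂ _+_ (n≤0⇒n≡0 (subst (_ ≤_) e (exceeds-mono j l))) (#longer-bounded j m e ls)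

  -- With xs the longest list, a column below length xs meets xs and the
  -- others in at most k more lists; a column from length xs on is empty.
  columnSum-sorted : ∀ n k {xss} → Linked (λ xs ys → length ys ≤ length xs) xss →
                     columnSum n k xss ≤ length (concat (take k xss))
  columnSum-sorted n zero    {xss}      _ = ≤-reflexive (Σ<-0 n)
  columnSum-sorted n (suc k) {[]}       _ = ≤-reflexive (Σ<-0 n)
  columnSum-sorted n (suc k) {xs ∷ xss} s = begin
    Σ< n (λ j → suc k ⊓ (exceeds j (length xs) + #longer j xss))
      ≤⟨ Σ<-mono n (λ j → column j (exceeds j (length xs)) refl) ⟩
    Σ< n (λ j → exceeds j (length xs) + (k ⊓ #longer j xss))
      ≡⟨ Σ<-+ n (λ j → exceeds j (length xs)) (λ j → k ⊓ #longer j xss) ⟩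
    Σ< n (λ j → exceeds j (length xs)) + columnSum n k xss
      ≤⟨ +-mono-≤ (Σ<-exceeds≤ n (length xs)) (columnSum-sorted n k (Linked.tail s)) ⟩
    length xs + length (concat (take k xss))
      ≡⟨ List.length-++ xs ⟨
    length (xs ++ concat (take k xss)) ∎
    where
      open ≤-Reasoning
      shorter : All (λ ys → length ys ≤ length xs) xss
      shorter with Linked.Linked⇒AllPairs (flip ≤-trans) s
      ... | l ∷ _ = l
      column : ∀ j b → exceeds j (length xs) ≡ b →
               suc k ⊓ (b + #longer j xss) ≤ b + (k ⊓ #longer j xss)
      column j zero    e rewrite #longer-bounded j (length xs) e shorter = z≤n
      column j (suc b) e with subst (_≤ 1) e (exceeds≤1 j (length xs))
      column j (suc zero) e | s≤s z≤n = ≤-refl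

  -- At most k of the lists, found by sorting, have at least this total length.
  columnSum-attained : ∀ n k xss → ∃[ yss ] ∃[ zss ]
    (yss ++ zss ↭ xss × length yss ≤ k × columnSum n k xss ≤ length (concat yss))
  columnSum-attained n k xss = take k (sort xss) , drop k (sort xss) ,
    ↭-trans (↭-reflexive (List.take++drop≡id k (sort xss))) (sort-↭ xss) ,
    subst (_≤ k) (sym (List.length-take k (sort xss))) (m⊓n≤m k _) ,
    subst (_≤ length (concat (take k (sort xss))))
      (Σ<-cong n λ j → cong (k ⊓_) (#longer-resp-↭ j (sort-↭ xss)))
      (columnSum-sorted n k (sort-↗ xss))

------------------------------------------------------------------------
-- Components and optimal defenses

module _ {n} (G : Graph n) (A : Subset n) where
  open Graph G
  open DecMembership (Fin._≟_ {n}) using (_∈?_)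

  -- Adjacency in G - A.
  _~ᴬ_ : Fin n → Fin n → Set
  x ~ᴬ y = x ~ y × x ∉ˢ A × y ∉ˢ A

  -- Joined by a walk in G - A, which may revisit vertices.
  Reachable : Fin n → Fin n → Set
  Reachable = Star _~ᴬ_

  Reachable-sym : ∀ {x y} → Reachable x y → Reachable y x
  Reachable-sym = reverse λ (x~y , x∉A , y∉A) → ~-sym x~y , y∉A , x∉A

  Path : Fin n → Fin n → Set
  Path x y = ∃[ vs ] IsPath G A x y vs

  path-suffix : ∀ {x y vs} → IsPath G A x y vs → ∀ {z} → z ∈ vs → Path z y
  path-suffix {vs = v ∷ vs} (isPath _ e l u a) (here refl) = v ∷ vs , isPath refl e l u a
  path-suffix {vs = v ∷ w ∷ vs} (isPath _ e (_ ∷ l) (_ ∷ u) (_ ∷ a)) (there z∈) =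
    path-suffix (isPath refl e l u a) z∈

  -- A walk is made a path from its end backwards: if a new first vertex
  -- already lies on the path, the detour before that occurrence is cut out.
  Reachable⇒Path : ∀ {x y} → x ∉ˢ A → Reachable x y → Path x y
  Reachable⇒Path {x} x∉A ε = x ∷ [] , isPath refl refl [-] ([] ∷ []) (x∉A ∷ [])
  Reachable⇒Path {x} x∉A ((x~z , _ , z∉A) ◅ r) with Reachable⇒Path z∉A r
  ... | vs , p with x ∈? vs
  Reachable⇒Path {x} x∉A ((x~z , _ , z∉A) ◅ r) | vs , p | yes x∈vs = path-suffix p x∈vs
  Reachable⇒Path {x} x∉A ((x~z , _ , z∉A) ◅ r) | v ∷ vs , isPath refl e l u a | no x∉vs =
    x ∷ v ∷ vs , isPath refl e (x~z ∷ l) (All.¬Any⇒All¬ _ x∉vs ∷ u) (x∉A ∷ a)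

  -- A list of vertices that, if all lie outside A, is empty or holds a
  -- connected component of G - A.
  record Component (C : List (Fin n)) : Set where
    field
      connected : ∀ {x y} → x ∈ C → y ∈ C → Reachable x y
      closed    : ∀ {x y} → x ∈ C → x ~ y → y ∉ˢ A → y ∈ C

  open Component

  -- A path of G - A never leaves a component.
  path-stays : ∀ {C} → Component C → ∀ {x y vs} → IsPath G A x y vs → x ∈ C → y ∈ C
  path-stays comp {vs = _ ∷ []} (isPath refl refl _ _ _) x∈ = x∈
  path-stays comp {vs = _ ∷ _ ∷ _} (isPath refl e (x~z ∷ l) (_ ∷ u) (_ ∷ z∉A ∷ a)) x∈ =
    path-stays comp (isPath refl e l u (z∉A ∷ a)) (closed comp x∈ x~z z∉A)

  -- Cs lists the components of G - A. Empty lists are harmless, and the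
  -- search below leaves one behind.
  module _ (Cs : List (List (Fin n))) (components : ∀ {C} → C ∈ Cs → Component C)
           (disjoint : Unique (concat Cs))
           (covers : ∀ {x} → x ∈ concat Cs ⇔ x ∉ˢ A) where

    lengths≤ : All (λ C → length C ≤ n) Cs
    lengths≤ = All.tabulate λ {C} C∈ → subst (length C ≤_) (List.length-tabulate {n = n} id)
      (≤-trans (length≤concat C∈) (unique-⊆⇒length≤ disjoint (λ {x} _ → ∈-allFin x)))
      where
        length≤concat : ∀ {C Cs} → C ∈ Cs → length C ≤ length (concat Cs)
        length≤concat {C} {_ ∷ Cs} (here refl) = subst (length C ≤_)
          (sym (List.length-++ C)) (m≤m+n (length C) _)
        length≤concat {Cs = B ∷ Cs} (there C∈) = subst (_ ≤_)
          (sym (List.length-++ B)) (m≤n⇒m≤o+n (length B) (length≤concat C∈))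

    module _ (D : Subset n) where

      hit? : Unary.Decidable (Any (_∈ˢ D))
      hit? = any? (_∈ˢ? D)

      -- Choosing one vertex of D from each list that meets D.
      transversal : ∀ Bs → Unique (concat Bs) → ∃[ ds ]
        (Unique ds × (∀ {d} → d ∈ ds → d ∈ˢ D × d ∈ concat Bs) ×
         length ds ≡ length (filter hit? Bs))
      transversal []       _ = [] , [] , (λ ()) , refl
      transversal (B ∷ Bs) u with transversal Bs (unique-++ʳ B u)
      ... | ds , uds , sub , eq with hit? B
      ... | no  _   = ds , uds , (λ d∈ → proj₁ (sub d∈) , ∈-++⁺ʳ B (proj₂ (sub d∈))) , eq
      ... | yes hit with find hit
      ... | d , d∈B , d∈D = d ∷ ds ,
        All.tabulate (λ e∈ → λ { refl → unique-++-disjoint B u d∈B (proj₂ (sub e∈)) }) ∷ uds ,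
        (λ { (here refl) → d∈D , ∈-++⁺ˡ d∈B
           ; (there e∈)  → proj₁ (sub e∈) , ∈-++⁺ʳ B (proj₂ (sub e∈)) }) ,
        cong suc eq

      -- All survivors lie in the components that meet D, and by the
      -- transversal there are at most k of these.
      payoff≤columnSum : ∀ {k} → ∣ D ∣ ≤ k → payoff G D A ≤ columnSum n k Cs
      payoff≤columnSum {k} D≤k = begin
        payoff G D A
          ≤⟨ ⊆⇒∣∣≤length (survivor-hit ∘ ∈-tabulate-does⁻ (survives? G D A)) ⟩
        length (concat (filter hit? Cs))
          ≤⟨ columnSum-upper n k _ (All.filter⁺ hit? lengths≤) few ⟩
        columnSum n k (filter hit? Cs)
          ≤⟨ columnSum-filter n k hit? Cs ⟩
        columnSum n k Cs                  ∎
        where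
          open ≤-Reasoning
          few : length (filter hit? Cs) ≤ k
          few with transversal Cs disjoint
          ... | ds , u , sub , eq =
            subst (_≤ k) eq (≤-trans (unique⇒length≤∣∣ u (proj₁ ∘ sub)) D≤k)
          survivor-hit : ∀ {x} → Survives G D A x → x ∈ concat (filter hit? Cs)
          survivor-hit (x∉A , y , y∈D , vs , p) with ∈-concat⁻′ Cs (Equivalence.from covers x∉A)
          ... | C , x∈C , C∈ = ∈-concat⁺′ x∈C (∈-filter⁺ hit? C∈
                (lose (path-stays (components C∈) p x∈C) y∈D))

    -- One vertex from each nonempty list.
    heads : List (List (Fin n)) → List (Fin n)
    heads []             = []
    heads ([] ∷ Bs)      = heads Bs
    heads ((x ∷ _) ∷ Bs) = x ∷ heads Bs

    length-heads : ∀ Bs → length (heads Bs) ≤ length Bs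
    length-heads []             = z≤n
    length-heads ([] ∷ Bs)      = m≤n⇒m≤1+n (length-heads Bs)
    length-heads ((x ∷ _) ∷ Bs) = s≤s (length-heads Bs)

    ∈-heads : ∀ {x B Bs} → B ∈ Bs → x ∈ B → ∃[ y ] (y ∈ B × y ∈ heads Bs)
    ∈-heads {B = y ∷ B}                 (here refl) _  = y , here refl , here refl
    ∈-heads           {Bs = [] ∷ Bs}    (there B∈) x∈ = ∈-heads B∈ x∈
    ∈-heads           {Bs = (_ ∷ _) ∷ Bs} (there B∈) x∈ with ∈-heads B∈ x∈
    ... | y , y∈B , y∈ = y , y∈B , there y∈

    -- One vertex in each of k largest components is an optimal defense.
    columnSum≤payoff : ∀ k → ∃[ D ] (∣ D ∣ ≤ k × columnSum n k Cs ≤ payoff G D A)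
    columnSum≤payoff k with columnSum-attained n k Cs
    ... | Bs , Rs , perm , Bs≤k , bound = D ,
      ≤-trans (⊆⇒∣∣≤length (∈-tabulate-does⁻ (_∈? heads Bs))) (≤-trans (length-heads Bs) Bs≤k) ,
      ≤-trans bound (unique⇒length≤∣∣ unique-Bs (∈-tabulate-does⁺ (survives? G D A) ∘ survive))
      where
        D : Subset n
        D = Vec.tabulate (does ∘ (_∈? heads Bs))
        unique-Bs : Unique (concat Bs)
        unique-Bs = unique-++ˡ (concat Bs) (subst Unique (sym (List.concat-++ Bs Rs))
          (unique-resp-↭ (↭-sym (concat-resp-↭ perm)) disjoint))
        survive : ∀ {x} → x ∈ concat Bs → Survives G D A x
        survive x∈ with ∈-concat⁻′ Bs x∈
        ... | B , x∈B , B∈ with ∈-heads B∈ x∈B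
        ... | y , y∈B , y∈ = x∉A , y , ∈-tabulate-does⁺ (_∈? heads Bs) y∈ ,
          Reachable⇒Path x∉A (connected (components B∈Cs) x∈B y∈B)
          where
            B∈Cs = ∈-resp-↭ perm (∈-++⁺ˡ B∈)
            x∉A  = Equivalence.to covers (∈-concat⁺′ x∈B B∈Cs)

    optimal-payoff : ∀ k δ → δ ≤ columnSum n k Cs ⇔ (∃[ D ] (∣ D ∣ ≤ k × δ ≤ payoff G D A))
    optimal-payoff k δ = mk⇔
      (λ δ≤ → let D , D≤k , b = columnSum≤payoff k in D , D≤k , ≤-trans δ≤ b)
      (λ (D , D≤k , δ≤) → ≤-trans δ≤ (payoff≤columnSum D D≤k))

------------------------------------------------------------------------
-- The number of arcs

module _ {n} {G : Graph n} (L : AdjacencyLists G) where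
  open Graph G
  open AdjacencyLists L

  degree : Fin n → ℕ
  degree v = length (neighbours v)

  -- The adjacency lists of G regarded as lists of ordered pairs.
  arcsFrom : Fin n → List (Fin n × Fin n)
  arcsFrom v = map (v ,_) (neighbours v)

  length-arcs : ∀ vs → length (concat (map arcsFrom vs)) ≡ sum (map degree vs)
  length-arcs []       = refl
  length-arcs (v ∷ vs) = trans (List.length-++ (arcsFrom v))
    (cong₂ _+_ (List.length-map (v ,_) (neighbours v)) (length-arcs vs))

  ∈-arcs⁻ : ∀ vs {x y} → (x , y) ∈ concat (map arcsFrom vs) → x ∈ vs × y ∈ neighbours x
  ∈-arcs⁻ (v ∷ vs) xy∈ with ∈-++⁻ (arcsFrom v) xy∈
  ... | inj₂ xy∈′ = let x∈ , y∈ = ∈-arcs⁻ vs xy∈′ in there x∈ , y∈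
  ... | inj₁ xy∈′ with ∈-map⁻ (v ,_) xy∈′
  ... | _ , y∈ , refl = here refl , y∈

  unique-arcs : ∀ {vs} → Unique vs → Unique (concat (map arcsFrom vs))
  unique-arcs {[]}     []       = []
  unique-arcs {v ∷ vs} (v∉ ∷ u) = Unique.++⁺ (Unique.map⁺ (cong proj₂) (unique v)) (unique-arcs u)
    λ (xy∈ , xy∈′) → disjoint xy∈ xy∈′
    where
      disjoint : ∀ {xy} → xy ∈ arcsFrom v → xy ∉ concat (map arcsFrom vs)
      disjoint xy∈ xy∈′ with ∈-map⁻ (v ,_) xy∈
      ... | _ , _ , refl = All.lookup v∉ (proj₁ (∈-arcs⁻ vs xy∈′)) refl

  -- Every arc is an edge or a reversed edge.
  sum-degrees≤ : sum (map degree (allFin n)) ≤ length edges + length edges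
  sum-degrees≤ = begin
    sum (map degree (allFin n))
      ≡⟨ length-arcs (allFin n) ⟨
    length (concat (map arcsFrom (allFin n)))
      ≤⟨ unique-⊆⇒length≤ (unique-arcs (Unique.allFin⁺ n)) arc-edge ⟩
    length (edges ++ map swap edges)
      ≡⟨ List.length-++ edges ⟩
    length edges + length (map swap edges)
      ≡⟨ cong (length edges +_) (List.length-map swap edges) ⟩
    length edges + length edges                 ∎
    where
      open ≤-Reasoning
      edge : ∀ {x y} → toℕ x < toℕ y → x ~ y → (x , y) ∈ edges
      edge x<y x~y = ∈-filter⁺ _ (∈-cartesianProduct⁺ (∈-allFin _) (∈-allFin _)) (x<y , x~y)
      arc-edge : ∀ {xy} → xy ∈ concat (map arcsFrom (allFin n)) → xy ∈ edges ++ map swap edges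
      arc-edge {x , y} xy∈ with Equivalence.to complete (proj₂ (∈-arcs⁻ (allFin n) xy∈)) | Fin.<-cmp x y
      ... | x~y | tri< x<y _ _ = ∈-++⁺ˡ (edge x<y x~y)
      ... | x~y | tri≈ _ x≡y _ = contradiction x~y (~-irr x≡y)
      ... | x~y | tri> _ _ y<x = ∈-++⁺ʳ edges (∈-map⁺ swap (edge y<x (~-sym x~y)))

------------------------------------------------------------------------
-- Memory and loops

update-same : ∀ {a} {X : Set a} (f : ℕ → X) {i j x} → j ≡ i → (f [ i ↦ x ]) j ≡ x
update-same f {i} {j} j≡i rewrite dec-true (j ≟ i) j≡i = refl

update-other : ∀ {a} {X : Set a} (f : ℕ → X) {i j x} → j ≢ i → (f [ i ↦ x ]) j ≡ f j
update-other f {i} {j} j≢i rewrite dec-false (j ≟ i) j≢i = refl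

-- The cells of f from i (inclusive) to j (exclusive) hold the list xs.
Segment : ∀ {n} → (ℕ → ℕ) → ℕ → List (Fin n) → ℕ → Set
Segment f i []       j = i ≡ j
Segment f i (x ∷ xs) j = f i ≡ toℕ x × Segment f (suc i) xs j

segment-≤ : ∀ {n f i j} (xs : List (Fin n)) → Segment f i xs j → i ≤ j
segment-≤ []       refl    = ≤-refl
segment-≤ (x ∷ xs) (_ , s) = <⇒≤ (segment-≤ xs s)

segment-empty : ∀ {n f i j} {xs : List (Fin n)} → Segment f i xs j → j ≤ i → xs ≡ []
segment-empty {xs = []}     _       _   = refl
segment-empty {xs = x ∷ xs} (_ , s) j≤i = contradiction (segment-≤ xs s) (≤⇒≯ j≤i)

segment-push : ∀ {n f i j m} {y : Fin n} xs → Segment f i xs j → m ≡ toℕ y →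
               Segment (f [ j ↦ m ]) i (xs ++ y ∷ []) (suc j)
segment-push {f = f} []       refl     eq = trans (update-same f refl) eq , refl
segment-push {f = f} (x ∷ xs) (fi , s) eq =
  trans (update-other f (<⇒≢ (segment-≤ xs s))) fi , segment-push xs s eq

segment-there : ∀ {n l ls i j} (xs : List (Fin n)) → Segment (cells ls) i xs j →
                Segment (cells (l ∷ ls)) (suc i) xs (suc j)
segment-there []       eq       = cong suc eq
segment-there (x ∷ xs) (eq , s) = eq , segment-there xs s

segment-here : ∀ {n ls} (xs : List (Fin n)) → Segment (cells (map toℕ xs ++ ls)) 0 xs (length xs)
segment-here []       = refl
segment-here (x ∷ xs) = refl , segment-there xs (segment-here xs)

segment-skip : ∀ {n ls i j} ks {xs : List (Fin n)} → Segment (cells ls) i xs j →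
               Segment (cells (ks ++ ls)) (length ks + i) xs (length ks + j)
segment-skip []       s      = s
segment-skip (k ∷ ks) {xs} s = segment-there xs (segment-skip ks s)

-- The offsets of the concatenated lists delimit each of them.
segment-concat : ∀ {n m} (g : Fin m → List (Fin n)) u →
  Segment (cells (map toℕ (concat (tabulate g))))
          (sum (take (toℕ u) (tabulate (length ∘ g)))) (g u)
          (sum (take (suc (toℕ u)) (tabulate (length ∘ g))))
segment-concat g zero
  rewrite List.map-++ toℕ (g zero) (concat (tabulate (g ∘ suc))) | +-identityʳ (length (g zero)) =
  segment-here (g zero)
segment-concat g (suc u)
  rewrite List.map-++ toℕ (g zero) (concat (tabulate (g ∘ suc)))
        | sym (List.length-map toℕ (g zero)) =
  segment-skip (map toℕ (g zero)) {xs = g (suc u)} (segment-concat (g ∘ suc) u)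

cells-applyUpTo : ∀ f {m i} → i < m → cells (applyUpTo f m) i ≡ f i
cells-applyUpTo f {suc m} {zero}  _         = refl
cells-applyUpTo f {suc m} {suc i} (s≤s i<m) = cells-applyUpTo (f ∘ suc) i<m

cells-toList : ∀ {n} {a} {X : Set a} (f : X → ℕ) (xs : Vec.Vec X n) x →
               cells (Vec.toList (Vec.map f xs)) (toℕ x) ≡ f (Vec.lookup xs x)
cells-toList f (y Vec.∷ xs) zero    = refl
cells-toList f (y Vec.∷ xs) (suc x) = cells-toList f xs x

-- The adjacency list of u, found through the offsets.
segment-neighbours : ∀ {n} {G : Graph n} (L : AdjacencyLists G) →
  let open AdjacencyLists L in ∀ {f g i u} → f ≡ cells offsets → g ≡ cells targets → i ≡ toℕ u →
  Segment g (f i) (neighbours u) (f (suc i))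
segment-neighbours {n} L {u = u} refl refl refl
  rewrite cells-applyUpTo (λ v → sum (take v (AdjacencyLists.degrees L))) (m<n⇒m<1+n (Fin.toℕ<n u))
        | cells-applyUpTo (λ v → sum (take v (AdjacencyLists.degrees L))) (s<s (Fin.toℕ<n u))
        | List.map-tabulate {n = n} id (length ∘ AdjacencyLists.neighbours L)
        | List.map-tabulate {n = n} id (AdjacencyLists.neighbours L) =
  segment-concat (AdjacencyLists.neighbours L) u

-- A loop whose invariant carries a number that every round decreases; if a
-- round of the body takes at most C steps, then the loop takes C + 1 steps
-- per unit of that number, and one step to stop.
while-rule : ∀ {ℓ x y P C} (Inv : ℕ → State → Set ℓ) →
  (∀ {m σ} → Inv m σ → reg σ x < reg σ y →
    ∃[ σ′ ] ∃[ t ] ∃[ m′ ] (P , σ ⇓ σ′ # t × t ≤ C × m′ < m × Inv m′ σ′)) →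
  ∀ {m σ} → Inv m σ →
  ∃[ σ′ ] ∃[ t ] ∃[ m′ ]
    (whileLess x y P , σ ⇓ σ′ # t × t ≤ suc (m * suc C) × Inv m′ σ′ × reg σ′ y ≤ reg σ′ x)
while-rule {x = x} {y} {P} {C} Inv round {m} = loop (<-wellFounded m)
  where
    loop : ∀ {m σ} → Acc _<_ m → Inv m σ → ∃[ σ′ ] ∃[ t ] ∃[ m′ ]
      (whileLess x y P , σ ⇓ σ′ # t × t ≤ suc (m * suc C) × Inv m′ σ′ × reg σ′ y ≤ reg σ′ x)
    loop {m} {σ} (acc rs) inv with reg σ x <? reg σ y
    ... | no  x≮y = σ , 1 , m , ⇓stop (≮⇒≥ x≮y) , s≤s z≤n , inv , ≮⇒≥ x≮y
    ... | yes x<y with round inv x<y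
    ... | σ′ , s , m′ , run , s≤C , m′<m , inv′ with loop (rs m′<m) inv′
    ... | σ″ , t , m″ , run′ , t≤ , inv″ , x≮y =
      σ″ , suc (s + t) , m″ , ⇓loop x<y run run′ , s≤s bound , inv″ , x≮y
      where
        open ≤-Reasoning
        bound : s + t ≤ m * suc C
        bound = begin
          s + t                   ≤⟨ +-mono-≤ s≤C t≤ ⟩
          C + suc (m′ * suc C)    ≡⟨ +-suc C (m′ * suc C) ⟩
          suc m′ * suc C          ≤⟨ *-monoˡ-≤ (suc C) m′<m ⟩
          m * suc C               ∎

------------------------------------------------------------------------
-- The program

-- The search starts from each vertex that rootᵣ runs through, unless that
-- vertex is marked already. The queue occupies the cells of queueₐ from
-- frontᵣ to backᵣ, the part of the adjacency list still to be followed the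
-- cells of targetsₐ from nextᵣ to stopᵣ, and positionᵣ counts the vertices
-- taken from the queue since the last root. oneᵣ is kept at 1, the mark of
-- attacked and discovered vertices: marksₐ is the array of the attack,
-- and columnsₐ holds the terms of the column sum totalᵣ.
nᵣ kᵣ δᵣ rootᵣ frontᵣ backᵣ positionᵣ nextᵣ stopᵣ vertexᵣ valueᵣ totalᵣ oneᵣ : Reg
nᵣ      = 0
kᵣ      = 1
δᵣ      = 2
rootᵣ   = 3
frontᵣ  = 4
backᵣ   = 5
positionᵣ  = 6
nextᵣ   = 7
stopᵣ   = 8
vertexᵣ = 9
valueᵣ  = 10
totalᵣ  = 11
oneᵣ    = 12

offsetsₐ targetsₐ marksₐ queueₐ columnsₐ : Arr
offsetsₐ = 0
targetsₐ = 1
marksₐ   = 2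
queueₐ   = 3
columnsₐ = 4

-- Mark the vertex held by x and append it to the queue.
discover : Reg → Program
discover x = store marksₐ x oneᵣ ⨾ store queueₐ backᵣ x ⨾ inc backᵣ

-- Discover the endpoint of the next arc unless it is marked.
followArc : Program
followArc =
  load vertexᵣ targetsₐ nextᵣ ⨾ inc nextᵣ ⨾ load valueᵣ marksₐ vertexᵣ ⨾
  ifLess valueᵣ oneᵣ (discover vertexᵣ) skip

-- Take a vertex from the queue. As the vertex number positionᵣ of its
-- component, it adds one to that column unless the column has reached k.
scanVertex : Program
scanVertex =
  load vertexᵣ queueₐ frontᵣ ⨾ inc frontᵣ ⨾
  load valueᵣ columnsₐ positionᵣ ⨾
  ifLess valueᵣ kᵣ (inc valueᵣ ⨾ store columnsₐ positionᵣ valueᵣ ⨾ inc totalᵣ) skip ⨾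
  inc positionᵣ ⨾ load nextᵣ offsetsₐ vertexᵣ ⨾ inc vertexᵣ ⨾ load stopᵣ offsetsₐ vertexᵣ

-- Start a new component at rootᵣ or, if that vertex is marked, pass on.
tryRoot : Program
tryRoot =
  load valueᵣ marksₐ rootᵣ ⨾
  ifLess valueᵣ oneᵣ (discover rootᵣ ⨾ const positionᵣ 0) (inc rootᵣ)

-- A root is passed only when the queue and the pending arcs are exhausted,
-- so that no component is left unfinished when rootᵣ reaches nᵣ.
round : Program
round = ifLess nextᵣ stopᵣ followArc (ifLess frontᵣ backᵣ scanVertex tryRoot)

program : Program
program =
  const oneᵣ 1 ⨾ whileLess rootᵣ nᵣ round ⨾
  ifLess totalᵣ δᵣ (const 0 0) (const 0 1)

------------------------------------------------------------------------
-- The search and its invariant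

module _ {a} {X : Set a} where

  remove : ∀ {w : X} {xs} → w ∈ xs → ∃[ ys ] (xs ↭ w ∷ ys)
  remove {w} w∈ with ∈-∃++ w∈
  ... | as , bs , refl = as ++ bs , shift w as bs

  #longer-same : ∀ {j} (u : X) xs xss → j ≢ length xs →
                 #longer j ((u ∷ xs) ∷ xss) ≡ #longer j (xs ∷ xss)
  #longer-same {j} u xs xss j≢ = cong (_+ #longer j xss) (exceeds-suc-≢ j (length xs) j≢)

  #longer-grow : ∀ (u : X) xs xss →
                 #longer (length xs) ((u ∷ xs) ∷ xss) ≡ suc (#longer (length xs) (xs ∷ xss))
  #longer-grow u xs xss rewrite exceeds-suc (length xs) | exceeds-self (length xs) = refl

-- A term k ⊓ m of the column sum grows with m exactly while it is below k.
⊓-suc-< : ∀ {k m} → k ⊓ m < k → k ⊓ suc m ≡ suc (k ⊓ m)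
⊓-suc-< {suc k} {zero}  _       = cong suc (⊓-zeroʳ k)
⊓-suc-< {suc k} {suc m} (s≤s l) = cong suc (⊓-suc-< l)

⊓-suc-≥ : ∀ {k m} → k ≤ k ⊓ m → k ⊓ suc m ≡ k ⊓ m
⊓-suc-≥ {zero}          _       = refl
⊓-suc-≥ {suc k} {suc m} (s≤s l) = cong suc (⊓-suc-≥ l)

-- The loop body takes at most 13 steps, the loop adds one to each round, and
-- at most 3 z rounds are made: this is the source of 42. The remaining 4
-- steps are the first instruction, the loop exit and the final test.
total-time : ∀ {t p z} → t ≤ suc (p * 14) → p ≤ 3 * z → 1 + (t + 2) ≤ 42 * suc z
total-time {t} {p} {z} t≤ p≤ = begin
  1 + (t + 2)               ≤⟨ s≤s (+-monoˡ-≤ 2 t≤) ⟩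
  2 + (p * 14 + 2)          ≤⟨ +-monoʳ-≤ 2 (+-monoˡ-≤ 2 (*-monoˡ-≤ 14 p≤)) ⟩
  2 + (3 * z * 14 + 2)      ≡⟨ cong (2 +_) (+-comm (3 * z * 14) 2) ⟩
  4 + 3 * z * 14            ≡⟨ cong (4 +_) (*-comm (3 * z) 14) ⟩
  4 + 14 * (3 * z)          ≡⟨ cong (4 +_) (*-assoc 14 3 z) ⟨
  4 + 42 * z                ≤⟨ +-monoˡ-≤ (42 * z) (≤ᵇ⇒≤ 4 42 _) ⟩
  42 + 42 * z               ≡⟨ *-suc 42 z ⟨
  42 * suc z                ∎
  where open ≤-Reasoning

module _ (I : Instance) where
  open Instance I
  open Graph graph
  open AdjacencyLists adjLists

  -- The vertices of G - A.
  alive : List (Fin n)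
  alive = filter (λ x → ¬? (x ∈ˢ? attack)) (allFin n)

  ∈-alive⁺ : ∀ {x} → x ∉ˢ attack → x ∈ alive
  ∈-alive⁺ x∉ = ∈-filter⁺ _ (∈-allFin _) x∉

  ∈-alive⁻ : ∀ {x} → x ∈ alive → x ∉ˢ attack
  ∈-alive⁻ x∈ = proj₂ (∈-filter⁻ (λ x → ¬? (x ∈ˢ? attack)) {xs = allFin n} x∈)

  -- The state of the search: the unmarked vertices of G - A, the queue, the
  -- heads of the arcs still to be followed, the vertices of the present
  -- component that have left the queue (the latest first), the earlier
  -- components, and the candidate for the next root.
  record Search : Set where
    constructor search
    field
      fresh queue arcs scanned : List (Fin n)
      done                     : List (List (Fin n))
      root                     : ℕ

    -- The part of the present component discovered so far.
    current : List (Fin n)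
    current = queue ++ scanned

  -- The invariant of the search. Every neighbour in G - A of a scanned vertex
  -- is discovered or is the head of a pending arc, so that the present
  -- component is closed once no arc and no vertex is pending. The last two
  -- fields say that all vertices before root are marked, and that nothing is
  -- pending when the loop stops.
  record Valid (s : Search) : Set where
    open Search s
    field
      partition  : fresh ++ (current ++ concat done) ↭ alive
      components : ∀ {C} → C ∈ done → Component graph attack C
      connected  : ∀ {x y} → x ∈ current → y ∈ current → Reachable graph attack x y
      explored   : ∀ {x y} → x ∈ scanned → x ~ y → y ∉ˢ attack → y ∈ current ⊎ y ∈ arcs
      sources    : ∀ {y} → y ∈ arcs → ∃[ x ] (x ∈ scanned × x ~ y)
      passed     : ∀ {x} → x ∈ fresh → root ≤ toℕ x
      finished   : n ≤ root → queue ≡ [] × arcs ≡ []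

    everything-unique : Unique (fresh ++ (current ++ concat done))
    everything-unique = unique-resp-↭ (↭-sym partition) (Unique.filter⁺ _ (Unique.allFin⁺ n))

    fresh-unique : Unique fresh
    fresh-unique = unique-++ˡ fresh everything-unique

    discovered-unique : Unique (current ++ concat done)
    discovered-unique = unique-++ʳ fresh everything-unique

    fresh-alive : ∀ {x} → x ∈ fresh → x ∉ˢ attack
    fresh-alive x∈ = ∈-alive⁻ (∈-resp-↭ partition (∈-++⁺ˡ x∈))

    current-alive : ∀ {x} → x ∈ current → x ∉ˢ attack
    current-alive x∈ = ∈-alive⁻ (∈-resp-↭ partition (∈-++⁺ʳ fresh (∈-++⁺ˡ x∈)))

    -- A marked neighbour is not in an earlier component, since that one is
    -- closed and would then contain both ends of the edge.
    neighbour-current : ∀ {x y} → x ∈ current → x ~ y → y ∉ˢ attack → y ∉ fresh → y ∈ current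
    neighbour-current {x} {y} x∈ x~y y∉A y∉fresh
      with ∈-++⁻ fresh (∈-resp-↭ (↭-sym partition) (∈-alive⁺ y∉A))
    ... | inj₁ y∈ = contradiction y∈ y∉fresh
    ... | inj₂ y∈ with ∈-++⁻ current y∈
    ... | inj₁ y∈current = y∈current
    ... | inj₂ y∈done with ∈-concat⁻′ done y∈done
    ... | C , y∈C , C∈ = contradiction
      (∈-concat⁺′ (Component.closed (components C∈) y∈C (~-sym x~y) (current-alive x∈)) C∈)
      (unique-++-disjoint current discovered-unique x∈)

    current-component : queue ≡ [] → arcs ≡ [] → Component graph attack scanned
    current-component refl refl = record
      { connected = connected
      ; closed    = λ x∈ x~y y∉A → case-explored (explored x∈ x~y y∉A) }
      where
        case-explored : ∀ {y} → y ∈ scanned ⊎ y ∈ [] → y ∈ scanned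
        case-explored (inj₁ y∈) = y∈

    scanned<n : ∀ {u q} → queue ≡ u ∷ q → length scanned < n
    scanned<n {u} {q} refl = begin
      suc (length scanned)
        ≤⟨ s≤s (m≤n+m (length scanned) (length q)) ⟩
      suc (length q + length scanned)
        ≡⟨ cong suc (List.length-++ q) ⟨
      length current
        ≤⟨ unique-⊆⇒length≤ (unique-++ˡ current discovered-unique)
             (λ {x} _ → ∈-allFin x) ⟩
      length (allFin n)
        ≡⟨ List.length-tabulate {n = n} id ⟩
      n                                   ∎
      where open ≤-Reasoning

  -- The mark m of vertex x: 0 for a fresh vertex, 1 for any other.
  Mark : List (Fin n) → Fin n → ℕ → Set
  Mark fresh x m = (x ∈ fresh × m ≡ 0) ⊎ (x ∉ fresh × m ≡ 1)

  -- The machine state σ holds the search s.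
  record Represents (s : Search) (σ : State) : Set where
    open Search s
    field
      n-eq       : reg σ nᵣ ≡ n
      k-eq       : reg σ kᵣ ≡ k
      δ-eq       : reg σ δᵣ ≡ δ
      one-eq     : reg σ oneᵣ ≡ 1
      root-eq    : reg σ rootᵣ ≡ root
      position-eq   : reg σ positionᵣ ≡ length scanned
      total-eq   : reg σ totalᵣ ≡ columnSum n k (scanned ∷ done)
      offsets-eq : arr σ offsetsₐ ≡ cells offsets
      targets-eq : arr σ targetsₐ ≡ cells targets
      marks      : ∀ x → Mark fresh x (arr σ marksₐ (toℕ x))
      queued     : Segment (arr σ queueₐ) (reg σ frontᵣ) queue (reg σ backᵣ)
      pending    : Segment (arr σ targetsₐ) (reg σ nextᵣ) arcs (reg σ stopᵣ)
      columns    : ∀ j → arr σ columnsₐ j ≡ k ⊓ #longer j (scanned ∷ done)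

  -- A bound on the number of remaining rounds. A vertex v is discovered once
  -- (at a root, this takes a round of its own), leaves the queue once, and
  -- each of its arcs is followed once: 2 + degree v rounds while it is fresh,
  -- 1 + degree v once it is queued. This counts one round too many for a
  -- vertex discovered along an arc. Each root is passed in one round.
  potential : Search → ℕ
  potential (search fresh queue arcs _ _ root) =
    (n ∸ root) + (sum (map ((2 +_) ∘ degree adjLists) fresh) +
                 (sum (map ((1 +_) ∘ degree adjLists) queue) + length arcs))

  -- The loop invariant, with the potential m of the search.
  Invariant : ℕ → State → Set
  Invariant m σ = ∃[ s ] (Valid s × Represents s σ × potential s ≡ m)

  -- From s and σ, the branch P makes one round of the search. The bound 11 is
  -- the cost of scanVertex, the longest branch.
  Round : Search → State → Program → Set
  Round s σ P = ∃[ σ′ ] ∃[ t ] ∃[ s′ ]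
    (P , σ ⇓ σ′ # t × t ≤ 11 × potential s′ < potential s × Valid s′ × Represents s′ σ′)

  mark-discovered : ∀ {fresh fresh′ w i v} f → Unique fresh → fresh ↭ w ∷ fresh′ →
    (∀ x → Mark fresh x (f (toℕ x))) → i ≡ toℕ w → v ≡ 1 →
    ∀ x → Mark fresh′ x ((f [ i ↦ v ]) (toℕ x))
  mark-discovered {fresh} {fresh′} {w} f u p marks refl v≡1 x
    with x Fin.≟ w | unique-resp-↭ p u
  ... | yes refl | w∉ ∷ _ = inj₂ ((λ w∈ → All.lookup w∉ w∈ refl) , trans (update-same f refl) v≡1)
  ... | no  x≢w  | _ with marks x
  ... | inj₁ (x∈ , eq) = inj₁ (drop-w (∈-resp-↭ p x∈) ,
      trans (update-other f (x≢w ∘ Fin.toℕ-injective)) eq)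
    where
      drop-w : x ∈ w ∷ fresh′ → x ∈ fresh′
      drop-w (here x≡w) = contradiction x≡w x≢w
      drop-w (there x∈) = x∈
  ... | inj₂ (x∉ , eq) = inj₂ (x∉ ∘ ∈-resp-↭ (↭-sym p) ∘ there ,
      trans (update-other f (x≢w ∘ Fin.toℕ-injective)) eq)

  weight-remove : ∀ {fresh fresh′ w} → fresh ↭ w ∷ fresh′ →
    sum (map ((2 +_) ∘ degree adjLists) fresh) ≡
    2 + degree adjLists w + sum (map ((2 +_) ∘ degree adjLists) fresh′)
  weight-remove p = sum-↭ (Perm.map⁺ _ p)

  followArc-round : ∀ {fresh queue w ws scanned done root σ} →
    let s = search fresh queue (w ∷ ws) scanned done root in
    Valid s → Represents s σ → reg σ rootᵣ < reg σ nᵣ → Round s σ followArc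
  followArc-round {fresh} {queue} {w} {ws} {scanned} {done} {root} {σ} valid rep root<n
    with Represents.marks rep w
  ... | inj₂ (w∉ , marked) = _ , _ , search fresh queue ws scanned done root ,
      ⇓seq ⇓load (⇓seq ⇓inc (⇓seq ⇓load (⇓else is-marked ⇓skip))) , ≤ᵇ⇒≤ _ _ _ ,
      +-monoʳ-< (n ∸ root) (+-monoʳ-< (sum (map _ fresh)) (+-monoʳ-< (sum (map _ queue)) ≤-refl)) ,
      record
        { partition = partition ; components = components ; connected = connected
        ; explored = explored′
        ; sources = sources ∘ there ; passed = passed
        ; finished = λ n≤ → contradiction n≤ (<⇒≱ (subst₂ _<_ root-eq n-eq root<n)) } ,
      record
        { n-eq = n-eq ; k-eq = k-eq ; δ-eq = δ-eq ; one-eq = one-eq ; root-eq = root-eq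
        ; position-eq = position-eq ; total-eq = total-eq
        ; offsets-eq = offsets-eq ; targets-eq = targets-eq ; marks = marks
        ; queued = queued ; pending = proj₂ pending ; columns = columns }
    where
      open Valid valid
      open Represents rep
      is-marked : reg σ oneᵣ ≤ arr σ marksₐ (arr σ targetsₐ (reg σ nextᵣ))
      is-marked = ≤-reflexive (trans one-eq (sym (trans (cong (arr σ marksₐ) (proj₁ pending)) marked)))
      explored′ : ∀ {x y} → x ∈ scanned → x ~ y → y ∉ˢ attack → y ∈ queue ++ scanned ⊎ y ∈ ws
      explored′ x∈ x~y y∉A with explored x∈ x~y y∉A
      ... | inj₁ y∈           = inj₁ y∈
      ... | inj₂ (there y∈)   = inj₂ y∈
      ... | inj₂ (here refl)  = inj₁ (neighbour-current (∈-++⁺ʳ queue x∈) x~y y∉A w∉)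
  ... | inj₁ (w∈ , unmarked) with remove w∈
  ... | fresh′ , p = _ , _ , search fresh′ (queue ++ w ∷ []) ws scanned done root ,
      ⇓seq ⇓load (⇓seq ⇓inc (⇓seq ⇓load (⇓then is-unmarked
        (⇓seq ⇓store (⇓seq ⇓store ⇓inc))))) , ≤ᵇ⇒≤ _ _ _ ,
      +-monoʳ-< (n ∸ root) decrease ,
      record
        { partition = partition′ ; components = components ; connected = connected′
        ; explored = explored′
        ; sources = sources ∘ there ; passed = passed ∘ ∈-resp-↭ (↭-sym p) ∘ there
        ; finished = λ n≤ → contradiction n≤ (<⇒≱ (subst₂ _<_ root-eq n-eq root<n)) } ,
      record
        { n-eq = n-eq ; k-eq = k-eq ; δ-eq = δ-eq ; one-eq = one-eq ; root-eq = root-eq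
        ; position-eq = position-eq ; total-eq = total-eq
        ; offsets-eq = offsets-eq ; targets-eq = targets-eq
        ; marks = mark-discovered (arr σ marksₐ) fresh-unique p marks (proj₁ pending) one-eq
        ; queued = segment-push queue queued (proj₁ pending)
        ; pending = proj₂ pending ; columns = columns }
    where
      open Valid valid
      open Represents rep
      is-unmarked : arr σ marksₐ (arr σ targetsₐ (reg σ nextᵣ)) < reg σ oneᵣ
      is-unmarked = subst₂ _<_ (sym (trans (cong (arr σ marksₐ) (proj₁ pending)) unmarked))
                               (sym one-eq) (s≤s z≤n)
      current′ : (queue ++ w ∷ []) ++ scanned ↭ w ∷ queue ++ scanned
      current′ = ↭-trans (↭-reflexive (List.++-assoc queue (w ∷ []) scanned)) (shift w queue scanned)
      partition′ : fresh′ ++ (((queue ++ w ∷ []) ++ scanned) ++ concat done) ↭ alive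
      partition′ = ↭-trans (++⁺ˡ fresh′ (++⁺ʳ (concat done) current′))
                  (↭-trans (shift w fresh′ _) (↭-trans (++⁺ʳ _ (↭-sym p)) partition))
      source : ∃[ x ] (x ∈ scanned × x ~ w)
      source = sources (here refl)
      reach : ∀ {x} → x ∈ w ∷ queue ++ scanned → Reachable graph attack x w
      reach (here refl) = ε
      reach (there x∈)  = let y , y∈ , y~w = source in
        connected x∈ (∈-++⁺ʳ queue y∈) ◅◅
        ((y~w , current-alive (∈-++⁺ʳ queue y∈) , fresh-alive w∈) ◅ ε)
      connected′ : ∀ {x y} → x ∈ (queue ++ w ∷ []) ++ scanned → y ∈ (queue ++ w ∷ []) ++ scanned →
                   Reachable graph attack x y
      connected′ x∈ y∈ = reach (∈-resp-↭ current′ x∈) ◅◅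
                         Reachable-sym graph attack (reach (∈-resp-↭ current′ y∈))
      explored′ : ∀ {x y} → x ∈ scanned → x ~ y → y ∉ˢ attack →
                  y ∈ (queue ++ w ∷ []) ++ scanned ⊎ y ∈ ws
      explored′ x∈ x~y y∉A with explored x∈ x~y y∉A
      ... | inj₁ y∈           = inj₁ (∈-resp-↭ (↭-sym current′) (there y∈))
      ... | inj₂ (there y∈)   = inj₂ y∈
      ... | inj₂ (here refl)  = inj₁ (∈-resp-↭ (↭-sym current′) (here refl))
      F  = sum (map ((2 +_) ∘ degree adjLists) fresh′)
      Q  = sum (map ((1 +_) ∘ degree adjLists) queue)
      open ≤-Reasoning
      decrease : F + (sum (map ((1 +_) ∘ degree adjLists) (queue ++ w ∷ [])) + length ws) <
                 sum (map ((2 +_) ∘ degree adjLists) fresh) + (Q + suc (length ws))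
      decrease = begin-strict
        F + (sum (map ((1 +_) ∘ degree adjLists) (queue ++ w ∷ [])) + length ws)
          ≡⟨ cong (λ z → F + (z + length ws))
               (trans (sum-↭ (Perm.map⁺ _ (shift w queue [])))
                      (cong (λ q → suc (degree adjLists w + sum (map _ q))) (List.++-identityʳ queue))) ⟩
        F + ((suc (degree adjLists w) + Q) + length ws)
          ≡⟨ cong (F +_) (+-assoc (suc (degree adjLists w)) Q (length ws)) ⟩
        F + (suc (degree adjLists w) + (Q + length ws))
          ≡⟨ +-assoc F (suc (degree adjLists w)) _ ⟨
        (F + suc (degree adjLists w)) + (Q + length ws)
          ≡⟨ cong (_+ (Q + length ws)) (+-comm F _) ⟩
        (suc (degree adjLists w) + F) + (Q + length ws)
          <⟨ +-mono-<-≤ (n<1+n (suc (degree adjLists w) + F)) (+-monoʳ-≤ Q (n≤1+n (length ws))) ⟩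
        (2 + degree adjLists w + F) + (Q + suc (length ws))
          ≡⟨ cong (_+ (Q + suc (length ws))) (weight-remove p) ⟨
        sum (map ((2 +_) ∘ degree adjLists) fresh) + (Q + suc (length ws)) ∎

  scanVertex-round : ∀ {fresh u q scanned done root σ} →
    let s = search fresh (u ∷ q) [] scanned done root in
    Valid s → Represents s σ → reg σ rootᵣ < reg σ nᵣ → Round s σ scanVertex
  scanVertex-round {fresh} {u} {q} {scanned} {done} {root} {σ} valid rep root<n = conclude
    where
      open Valid valid
      open Represents rep
      s′ : Search
      s′ = search fresh q (neighbours u) (u ∷ scanned) done root
      current′ : q ++ u ∷ scanned ↭ u ∷ q ++ scanned
      current′ = shift u q scanned
      explored′ : ∀ {x y} → x ∈ u ∷ scanned → x ~ y → y ∉ˢ attack →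
                  y ∈ q ++ u ∷ scanned ⊎ y ∈ neighbours u
      explored′ (here refl) x~y y∉A = inj₂ (Equivalence.from complete x~y)
      explored′ (there x∈)  x~y y∉A with explored x∈ x~y y∉A
      ... | inj₁ y∈ = inj₁ (∈-resp-↭ (↭-sym current′) y∈)
      valid′ : Valid s′
      valid′ = record
        { partition = ↭-trans (++⁺ˡ fresh (++⁺ʳ (concat done) current′)) partition
        ; components = components
        ; connected = λ x∈ y∈ → connected (∈-resp-↭ current′ x∈) (∈-resp-↭ current′ y∈)
        ; explored = explored′
        ; sources = λ y∈ → u , here refl , Equivalence.to complete y∈
        ; passed = passed
        ; finished = λ n≤ → contradiction n≤ (<⇒≱ (subst₂ _<_ root-eq n-eq root<n)) }
      d = degree adjLists u
      Q = sum (map ((1 +_) ∘ degree adjLists) q)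
      decrease : potential s′ < potential (search fresh (u ∷ q) [] scanned done root)
      decrease = +-monoʳ-< (n ∸ root) (+-monoʳ-< (sum (map _ fresh))
        (s≤s (≤-reflexive (trans (+-comm Q d) (sym (+-identityʳ (d + Q)))))))
      pending′ : Segment (arr σ targetsₐ) (arr σ offsetsₐ (arr σ queueₐ (reg σ frontᵣ))) (neighbours u)
                         (arr σ offsetsₐ (suc (arr σ queueₐ (reg σ frontᵣ))))
      pending′ = segment-neighbours adjLists offsets-eq targets-eq (proj₁ queued)
      l = length scanned
      X = #longer l (scanned ∷ done)
      column-eq : arr σ columnsₐ (reg σ positionᵣ) ≡ k ⊓ X
      column-eq = trans (columns (reg σ positionᵣ)) (cong (λ j → k ⊓ #longer j (scanned ∷ done)) position-eq)
      conclude : Round (search fresh (u ∷ q) [] scanned done root) σ scanVertex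
      conclude with arr σ columnsₐ (reg σ positionᵣ) <? reg σ kᵣ
      ... | yes c<k = _ , _ , s′ ,
        ⇓seq ⇓load (⇓seq ⇓inc (⇓seq ⇓load (⇓seq
          (⇓then c<k (⇓seq ⇓inc (⇓seq ⇓store ⇓inc)))
          (⇓seq ⇓inc (⇓seq ⇓load (⇓seq ⇓inc ⇓load)))))) , ≤ᵇ⇒≤ _ _ _ , decrease , valid′ ,
        record
          { n-eq = n-eq ; k-eq = k-eq ; δ-eq = δ-eq ; one-eq = one-eq ; root-eq = root-eq
          ; position-eq = cong suc position-eq
          ; total-eq = trans (cong suc total-eq) (sym (Σ<-increment (scanned<n refl) grow same))
          ; offsets-eq = offsets-eq ; targets-eq = targets-eq ; marks = marks
          ; queued = proj₂ queued ; pending = pending′ ; columns = columns′ }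
        where
          grow : k ⊓ #longer l ((u ∷ scanned) ∷ done) ≡ suc (k ⊓ X)
          grow = trans (cong (k ⊓_) (#longer-grow u scanned done))
                       (⊓-suc-< {k} {X} (subst₂ _<_ column-eq k-eq c<k))
          same : ∀ j → j ≢ l → k ⊓ #longer j ((u ∷ scanned) ∷ done) ≡ k ⊓ #longer j (scanned ∷ done)
          same j j≢l = cong (k ⊓_) (#longer-same u scanned done j≢l)
          columns′ : ∀ j → (arr σ columnsₐ [ reg σ positionᵣ ↦ suc (arr σ columnsₐ (reg σ positionᵣ)) ]) j ≡
                           k ⊓ #longer j ((u ∷ scanned) ∷ done)
          columns′ j with j ≟ l
          ... | yes refl = trans (update-same (arr σ columnsₐ) (sym position-eq))
                                 (trans (cong suc column-eq) (sym grow))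
          ... | no  j≢l  = trans (update-other (arr σ columnsₐ) (λ eq → j≢l (trans eq position-eq)))
                                 (trans (columns j) (sym (same j j≢l)))
      ... | no c≮k = _ , _ , s′ ,
        ⇓seq ⇓load (⇓seq ⇓inc (⇓seq ⇓load (⇓seq
          (⇓else (≮⇒≥ c≮k) ⇓skip)
          (⇓seq ⇓inc (⇓seq ⇓load (⇓seq ⇓inc ⇓load)))))) , ≤ᵇ⇒≤ _ _ _ , decrease , valid′ ,
        record
          { n-eq = n-eq ; k-eq = k-eq ; δ-eq = δ-eq ; one-eq = one-eq ; root-eq = root-eq
          ; position-eq = cong suc position-eq
          ; total-eq = trans total-eq (sym (Σ<-cong n same))
          ; offsets-eq = offsets-eq ; targets-eq = targets-eq ; marks = marks
          ; queued = proj₂ queued ; pending = pending′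
          ; columns = λ j → trans (columns j) (sym (same j)) }
        where
          same : ∀ j → k ⊓ #longer j ((u ∷ scanned) ∷ done) ≡ k ⊓ #longer j (scanned ∷ done)
          same j with j ≟ l
          ... | no  j≢l  = cong (k ⊓_) (#longer-same u scanned done j≢l)
          ... | yes refl = trans (cong (k ⊓_) (#longer-grow u scanned done))
                                 (⊓-suc-≥ {k} {X} (subst₂ _≤_ k-eq column-eq (≮⇒≥ c≮k)))

  tryRoot-round : ∀ {fresh scanned done root σ} →
    let s = search fresh [] [] scanned done root in
    Valid s → Represents s σ → reg σ rootᵣ < reg σ nᵣ → Round s σ tryRoot
  tryRoot-round {fresh} {scanned} {done} {root} {σ} valid rep root<n = conclude (marks v)
    where
      open Valid valid
      open Represents rep
      root<n′ : root < n
      root<n′ = subst₂ _<_ root-eq n-eq root<n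
      v : Fin n
      v = fromℕ< root<n′
      toℕ-v : root ≡ toℕ v
      toℕ-v = sym (Fin.toℕ-fromℕ< root<n′)
      root≡v : reg σ rootᵣ ≡ toℕ v
      root≡v = trans root-eq toℕ-v
      conclude : Mark fresh v (arr σ marksₐ (toℕ v)) →
                 Round (search fresh [] [] scanned done root) σ tryRoot
      conclude (inj₂ (v∉ , marked)) = _ , _ , search fresh [] [] scanned done (suc root) ,
        ⇓seq ⇓load (⇓else is-marked ⇓inc) , ≤ᵇ⇒≤ _ _ _ ,
        +-monoˡ-< _ (∸-monoʳ-< ≤-refl root<n′) ,
        record
          { partition = partition ; components = components ; connected = connected
          ; explored = explored ; sources = sources
          ; passed = λ x∈ → ≤∧≢⇒< (passed x∈) λ root≡x →
              v∉ (subst (_∈ fresh) (Fin.toℕ-injective (trans (sym root≡x) toℕ-v)) x∈)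
          ; finished = λ _ → refl , refl } ,
        record
          { n-eq = n-eq ; k-eq = k-eq ; δ-eq = δ-eq ; one-eq = one-eq ; root-eq = cong suc root-eq
          ; position-eq = position-eq ; total-eq = total-eq
          ; offsets-eq = offsets-eq ; targets-eq = targets-eq ; marks = marks
          ; queued = queued ; pending = pending ; columns = columns }
        where
          is-marked : reg σ oneᵣ ≤ arr σ marksₐ (reg σ rootᵣ)
          is-marked = ≤-reflexive (trans one-eq (sym (trans (cong (arr σ marksₐ) root≡v) marked)))
      conclude (inj₁ (v∈ , unmarked)) with remove v∈
      ... | fresh′ , p = _ , _ , search fresh′ (v ∷ []) [] [] (scanned ∷ done) root ,
        ⇓seq ⇓load (⇓then is-unmarked (⇓seq (⇓seq ⇓store (⇓seq ⇓store ⇓inc)) ⇓const)) , ≤ᵇ⇒≤ _ _ _ ,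
        +-monoʳ-< (n ∸ root) decrease ,
        record
          { partition = ↭-trans (shift v fresh′ _) (↭-trans (++⁺ʳ _ (↭-sym p)) partition)
          ; components = λ { (here refl) → current-component refl refl ; (there C∈) → components C∈ }
          ; connected = λ { (here refl) (here refl) → ε }
          ; explored = λ ()
          ; sources = λ ()
          ; passed = passed ∘ ∈-resp-↭ (↭-sym p) ∘ there
          ; finished = λ n≤ → contradiction n≤ (<⇒≱ root<n′) } ,
        record
          { n-eq = n-eq ; k-eq = k-eq ; δ-eq = δ-eq ; one-eq = one-eq ; root-eq = root-eq
          ; position-eq = refl ; total-eq = total-eq
          ; offsets-eq = offsets-eq ; targets-eq = targets-eq
          ; marks = mark-discovered (arr σ marksₐ) fresh-unique p marks root≡v one-eq
          ; queued = segment-push {f = arr σ queueₐ} [] queued root≡v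
          ; pending = pending ; columns = columns }
        where
          is-unmarked : arr σ marksₐ (reg σ rootᵣ) < reg σ oneᵣ
          is-unmarked = subst₂ _<_ (sym (trans (cong (arr σ marksₐ) root≡v) unmarked))
                               (sym one-eq) (s≤s z≤n)
          d = degree adjLists v
          F = sum (map ((2 +_) ∘ degree adjLists) fresh′)
          decrease : F + ((suc d + 0) + 0) < sum (map ((2 +_) ∘ degree adjLists) fresh) + 0
          decrease = subst₂ _<_
            (trans (+-comm (suc d) F) (cong (F +_) (sym (trans (+-identityʳ _) (+-identityʳ _)))))
            (sym (trans (+-identityʳ _) (weight-remove p)))
            ≤-refl

  -- Two steps for the tests that select the branch are added to the 11.
  round-step : ∀ {m σ} → Invariant m σ → reg σ rootᵣ < reg σ nᵣ →
    ∃[ σ′ ] ∃[ t ] ∃[ m′ ] (round , σ ⇓ σ′ # t × t ≤ 13 × m′ < m × Invariant m′ σ′)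
  round-step {σ = σ} (s , valid , rep , refl) root<n
    with reg σ nextᵣ <? reg σ stopᵣ
  round-step {σ = σ} (search _ _ [] _ _ _ , valid , rep , refl) root<n
    | yes next<stop = contradiction (Represents.pending rep) (<⇒≢ next<stop)
  round-step {σ = σ} (search _ _ (_ ∷ _) _ _ _ , valid , rep , refl) root<n
    | yes next<stop with followArc-round valid rep root<n
  ... | σ′ , t , s′ , run , t≤ , smaller , valid′ , rep′ =
    σ′ , suc t , potential s′ , ⇓then next<stop run , m≤n⇒m≤1+n (s≤s t≤) ,
    smaller , s′ , valid′ , rep′ , refl
  round-step {σ = σ} (s , valid , rep , refl) root<n
    | no next≮stop with segment-empty (Represents.pending rep) (≮⇒≥ next≮stop) | reg σ frontᵣ <? reg σ backᵣ
  round-step {σ = σ} (search _ [] _ _ _ _ , valid , rep , refl) root<n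
    | no next≮stop | refl | yes front<back = contradiction (Represents.queued rep) (<⇒≢ front<back)
  round-step {σ = σ} (search _ (_ ∷ _) _ _ _ _ , valid , rep , refl) root<n
    | no next≮stop | refl | yes front<back with scanVertex-round valid rep root<n
  ... | σ′ , t , s′ , run , t≤ , smaller , valid′ , rep′ =
    σ′ , suc (suc t) , potential s′ , ⇓else (≮⇒≥ next≮stop) (⇓then front<back run) , s≤s (s≤s t≤) ,
    smaller , s′ , valid′ , rep′ , refl
  round-step {σ = σ} (s , valid , rep , refl) root<n
    | no next≮stop | refl | no front≮back with segment-empty (Represents.queued rep) (≮⇒≥ front≮back)
  ... | refl with tryRoot-round valid rep root<n
  ... | σ′ , t , s′ , run , t≤ , smaller , valid′ , rep′ =
    σ′ , suc (suc t) , potential s′ , ⇓else (≮⇒≥ next≮stop) (⇓else (≮⇒≥ front≮back) run) , s≤s (s≤s t≤) ,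
    smaller , s′ , valid′ , rep′ , refl

  -- The empty list of scanned vertices later becomes an empty component.
  initial : Search
  initial = search alive [] [] [] [] 0

  initial-valid : Valid initial
  initial-valid = record
    { partition = ↭-reflexive (List.++-identityʳ alive) ; components = λ () ; connected = λ ()
    ; explored = λ () ; sources = λ () ; passed = λ _ → z≤n ; finished = λ _ → refl , refl }

  initial-marks : ∀ x → Mark alive x (arr (encode I) marksₐ (toℕ x))
  initial-marks x with x ∈ˢ? attack
  ... | yes x∈ = inj₂ ((λ x∈alive → ∈-alive⁻ x∈alive x∈) ,
        trans (cells-toList _ attack x) (cong (if_then 1 else 0) (Vec.[]=⇒lookup x∈)))
  ... | no  x∉ = inj₁ (∈-alive⁺ x∉ ,
        trans (cells-toList _ attack x) (unattacked (Vec.lookup attack x) refl))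
    where
      unattacked : ∀ b → Vec.lookup attack x ≡ b → (if b then 1 else 0) ≡ 0
      unattacked true  eq = contradiction (Vec.lookup⇒[]= x attack eq) x∉
      unattacked false _  = refl

  initial-represents : Represents initial (setReg oneᵣ 1 (encode I))
  initial-represents = record
    { n-eq = refl ; k-eq = refl ; δ-eq = refl ; one-eq = refl ; root-eq = refl ; position-eq = refl
    ; total-eq = sym (trans (Σ<-cong n (λ _ → ⊓-zeroʳ k)) (Σ<-0 n))
    ; offsets-eq = refl ; targets-eq = refl ; marks = initial-marks
    ; queued = refl ; pending = refl ; columns = λ _ → sym (⊓-zeroʳ k) }

  -- 1 for passing each vertex as a root, 2 + degree for discovering it and
  -- following its arcs.
  initial-potential : potential initial ≤ 3 * Graph.size graph
  initial-potential = begin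
    n + (sum (map ((2 +_) ∘ degree adjLists) alive) + 0)
      ≡⟨ cong (n +_) (+-identityʳ _) ⟩
    n + sum (map ((2 +_) ∘ degree adjLists) alive)
      ≤⟨ +-monoʳ-≤ n (weight-filter (allFin n)) ⟩
    n + (2 * length (allFin n) + sum (map (degree adjLists) (allFin n)))
      ≤⟨ +-monoʳ-≤ n (+-mono-≤ (≤-reflexive (cong (2 *_) (List.length-tabulate {n = n} id)))
                               (sum-degrees≤ adjLists)) ⟩
    n + (2 * n + (e + e))
      ≡⟨ +-assoc n (2 * n) (e + e) ⟨
    3 * n + (e + e)
      ≤⟨ +-monoʳ-≤ (3 * n) (+-monoʳ-≤ e (m≤m+n e (e + 0))) ⟩
    3 * n + 3 * e
      ≡⟨ *-distribˡ-+ 3 n e ⟨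
    3 * (n + e) ∎
    where
      open ≤-Reasoning
      e = length edges
      weight-filter : ∀ vs → sum (map ((2 +_) ∘ degree adjLists) (filter (λ x → ¬? (x ∈ˢ? attack)) vs)) ≤
                             2 * length vs + sum (map (degree adjLists) vs)
      weight-filter []       = z≤n
      weight-filter (v ∷ vs) = ≤-trans one-more (≤-reflexive rearrange)
        where
          d = degree adjLists v
          W = 2 * length vs + sum (map (degree adjLists) vs)
          one-more : sum (map ((2 +_) ∘ degree adjLists) (filter (λ x → ¬? (x ∈ˢ? attack)) (v ∷ vs))) ≤
                     (2 + d) + W
          one-more with does (¬? (v ∈ˢ? attack))
          ... | true  = +-monoʳ-≤ (2 + d) (weight-filter vs)
          ... | false = m≤n⇒m≤o+n (2 + d) (weight-filter vs)
          rearrange : (2 + d) + W ≡ 2 * length (v ∷ vs) + sum (map (degree adjLists) (v ∷ vs))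
          rearrange = trans
            (interchange +-commutativeSemigroup 2 d (2 * length vs) _)
            (cong (_+ (d + sum (map (degree adjLists) vs))) (sym (*-suc 2 (length vs))))

  -- When every root is passed, no vertex is fresh or pending.
  final-total : ∀ {s} → Valid s → n ≤ Search.root s →
    let open Search s in
    δ ≤ columnSum n k (scanned ∷ done) ⇔ (∃[ D ] (∣ D ∣ ≤ k × δ ≤ payoff graph D attack))
  final-total {search fresh queue arcs scanned done root} valid n≤root
    with Valid.finished valid n≤root | no-fresh fresh (Valid.passed valid)
    where
      no-fresh : ∀ xs → (∀ {x} → x ∈ xs → root ≤ toℕ x) → xs ≡ []
      no-fresh []       _  = refl
      no-fresh (x ∷ xs) ge = contradiction (≤-trans n≤root (ge (here refl))) (<⇒≱ (Fin.toℕ<n x))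
  ... | refl , refl | refl = optimal-payoff graph attack (scanned ∷ done)
      (λ { (here refl) → current-component refl refl ; (there C∈) → components C∈ })
      discovered-unique
      (mk⇔ (∈-alive⁻ ∘ ∈-resp-↭ partition) (∈-resp-↭ (↭-sym partition) ∘ ∈-alive⁺))
      k δ
    where open Valid valid

  search-loop : ∃[ σ ] ∃[ t ] ∃[ m ]
    (whileLess rootᵣ nᵣ round , setReg oneᵣ 1 (encode I) ⇓ σ # t ×
     t ≤ suc (potential initial * 14) × Invariant m σ × reg σ nᵣ ≤ reg σ rootᵣ)
  search-loop = while-rule Invariant round-step (initial , initial-valid , initial-represents , refl)

  -- Is there a defense of at most k vertices with payoff at least δ?
  Question : Set
  Question = ∃[ D ] (∣ D ∣ ≤ k × δ ≤ payoff graph D attack)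

  answer : ∀ {m σ} → Invariant m σ → reg σ nᵣ ≤ reg σ rootᵣ →
    ∃[ σ′ ] (ifLess totalᵣ δᵣ (const 0 0) (const 0 1) , σ ⇓ σ′ # 2 × (reg σ′ 0 ≡ 1 ⇔ Question))
  answer {σ = σ} (s , valid , rep , _) n≤root = decide (reg σ totalᵣ <? reg σ δᵣ)
    where
      open Represents rep
      question = final-total valid (subst₂ _≤_ n-eq root-eq n≤root)
      decide : Dec (reg σ totalᵣ < reg σ δᵣ) → ∃[ σ′ ]
        (ifLess totalᵣ δᵣ (const 0 0) (const 0 1) , σ ⇓ σ′ # 2 × (reg σ′ 0 ≡ 1 ⇔ Question))
      decide (yes total<δ) = setReg 0 0 σ , ⇓then total<δ ⇓const ,
        mk⇔ (λ ()) λ q → contradiction (Equivalence.from question q)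
          (<⇒≱ (subst₂ _<_ total-eq δ-eq total<δ))
      decide (no total≮δ) = setReg 0 1 σ , ⇓else (≮⇒≥ total≮δ) ⇓const ,
        mk⇔ (λ _ → Equivalence.to question (subst₂ _≤_ δ-eq total-eq (≮⇒≥ total≮δ))) (λ _ → refl)

  program-correct : ∃[ σ ] ∃[ t ]
    (program , encode I ⇓ σ # t × t ≤ 42 * suc (Graph.size graph) × (reg σ 0 ≡ 1 ⇔ Question))
  program-correct =
    let σ  , t , _ , run , t≤ , inv , n≤root = search-loop
        σ′ , run′ , correct = answer inv n≤root
    in σ′ , 1 + (t + 2) , ⇓seq ⇓const (⇓seq run run′) , total-time t≤ initial-potential , correct

mainTheorem1 : SolvableInLinearTime encode (λ I → Graph.size (Instance.graph I))
    (λ I → let open Instance I in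
    ∃[ D ] (∣ D ∣ ≤ k × δ ≤ payoff graph D attack))
mainTheorem1 = program , 42 , program-correct
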